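{- Every characteristic (clause set) term schema $\Theta$ (that is, $\Theta=\Theta^{\varnothing}(\varphi)$ for some propositional proof schema $\varphi$) has a refutation schema, i.e. there exist an atom set schema $\mathcal{A}$ and a resolution proof schema $\rho$ such that $\langle\Theta,\mathcal{A},\rho\rangle$ is a refutation schema: $\mathcal{A}$ is an atom set schema for $\Theta$, and for every $N\in\mathbb{N}$, $\rho\downarrow N$ is a resolution deduction from $\mathrm{CL}^t(\mathcal{A}\downarrow N)$ with end-clause $\vdash$.
   Context: **Basics.** Arithmetic expressions are $\alpha\times n+\beta$ with $\alpha,\beta\in\mathbb{N}$ and $n$ the single parameter; $(\alpha\times n+\beta)\downarrow N=\alpha N+\beta$; $a[n\mapsto b]$ is substitution. An atom is $P(\alpha)$ with $P$ a propositional symbol and $\alpha\in\mathbb{N}$; an atom schema is $P(a)$ with $a$ an arithmetic expression. Propositional schemata are built from atom schemata and a variable $X^{\mathrm{prop}}$ by $\neg,\wedge,\vee,\supset$ and expressions $\mathbf{P}(a)$, where $\mathbf{P}$ is a defined symbol with specification $\mathbf{P}(0)\equiv F_{base}$ (a propositional formula), $\mathbf{P}(n+1)\equiv F_{rec}$ (a schema that may contain $X^{\mathrm{prop}}$, standing for $\mathbf{P}(n)$, and previously defined symbols but not $\mathbf{P}$); outside specifications, schemata do not contain $X^{\mathrm{prop}}$. Evaluation $F\downarrow N$ replaces $n$ by $N$ and unfolds definitions. The relation $\leftrightarrow_{def}$ is the reflexive symmetric closure of $\mathbf{P}(0)\leftrightarrow_{def}F_{base}$, $\mathbf{P}(\alpha\times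 n+(\beta+1))\leftrightarrow_{def}F_{rec}[n\mapsto\alpha\times n+\beta][X^{\mathrm{prop}}\mapsto\mathbf{P}(\alpha\times n+\beta)]$, extended componentwise to sequents. A sequent (schema) is $\Gamma\vdash\Delta$ with $\Gamma,\Delta$ finite lists of formulas (schemata); a clause (schema) is a sequent of atoms (atom schemata), clauses being identified up to order of atoms. $(\Gamma\vdash\Delta)\circ(\Pi\vdash\Lambda)=\Gamma,\Pi\vdash\Delta,\Lambda$; $\mathcal{C}\times\mathcal{D}=\{C\circ D\mid C\in\mathcal{C},D\in\mathcal{D}\}$. **Proof schemata.** Initial sequents are $P(a)\vdash P(a)$. Inference rules: left/right weakening, contraction, exchange; cut (from $\Gamma\vdash\Delta,F$ and $F,\Pi\vdash\Lambda$ infer $\Gamma,\Pi\vdash\Delta,\Lambda$); $\neg\colon l,\neg\colon r$; $\wedge\colon l_1$, $\wedge\colon l_2$ (from $F,\Gamma\vdash\Delta$, resp. $G,\Gamma\vdash\Delta$, infer $F\wedge G,\Gamma\vdash\Delta$); $\wedge\colon r$ (from $\Gamma\vdash\Delta,F$ and $\Gamma\vdash\Delta,G$ infer $\Gamma\vdash\Delta,F\wedge G$); $\vee\colon l$ (from $F,\Gamma\vdash\Delta$ and $G,\Gamma\vdash\Delta$ infer $F\vee G,\Gamma\vdash\Delta$), $\vee\colon r_1$, $\vee\colon r_2$ dually to $\wedge\colon l$; $\supset\colon l$ (from $\Gamma\vdash\Delta,F$ and $G,\Pi\vdash\Lambda$ infer $F\supset G,\Gamma,\Pi\vdash\Delta,\Lambda$);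 $\supset\colon r$ (from $F,\Gamma\vdash\Delta,G$ infer $\Gamma\vdash\Delta,F\supset G$); the rule $def$ (from $S$ infer $S'$ if $S\leftrightarrow_{def}S'$); and proof links. Proof schemata are built inductively from initial sequents, these inferences, and expressions $\boldsymbol{\varphi}(a)$, where $\boldsymbol{\varphi}$ is specified by $\boldsymbol{\varphi}(0)\equiv\varphi_{base}$, a propositional proof of $S\downarrow 0$, and $\boldsymbol{\varphi}(n+1)\equiv\varphi_{rec}$, a proof schema of $S[n\mapsto n+1]$ which may use proof links $\boldsymbol{\varphi}(n)$ as leaves with sequent $S$ (and previously defined proof schemata); then $\boldsymbol{\varphi}(a)$ has end-sequent $S[n\mapsto a]$. Outside specifications no proof links occur. **Clause set term schemata.** Built from $[C]$ ($C$ a clause schema), variables $X_1^{\mathrm{term}},X_2^{\mathrm{term}},\dots$, $\oplus$, $\otimes$, and $\mathbf{T}(a)$, where symbols $\mathbf{T}^1,\dots,\mathbf{T}^M$ are defined by mutual recursion $\mathbf{T}^i(0)\equiv T^i_{base}$ (ground), $\mathbf{T}^i(n+1)\equiv T^i_{rec}$, in which $X_j^{\mathrm{term}}$ stands for $\mathbf{T}^j(n)$ (previously defined symbols may occur); outside specifications no variables occur. $T\downarrow N$ evaluates to a ground term; $|[C]|=\{C\}$, $|X\oplus Y|=|X|\cup|Y|$, $|X\otimes Y|=|X|\times|Y|$. **Characteristic term schema.** A configuration $\Omega$ of a sequent marks each formula occurrence by $\blacksquare$ (tracked) or $\square$; $S\cdot\Omega$ is the subsequent of tracked formulas; $\varnothing$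 tracks nothing. A configuration on the conclusion of an inference induces one on each premise: context formulas keep their mark, auxiliary formulas get the mark of the principal formula, both cut formulas get $\blacksquare$, structural rules copy marks in the obvious way. $\Theta^{\Omega}(\varphi)$ is: $[S\cdot\Omega]$ for an initial sequent $S$; $\Theta^{\Omega'}(\varphi')$ (with $\Omega'$ induced) for a last unary inference (including $def$); for a last binary inference with subproofs $\varphi_1,\varphi_2$ and induced configurations $\Omega_1,\Omega_2$, $\Theta^{\Omega_1}(\varphi_1)\oplus\Theta^{\Omega_2}(\varphi_2)$ if it is a cut or its principal formula is tracked, and $\Theta^{\Omega_1}(\varphi_1)\otimes\Theta^{\Omega_2}(\varphi_2)$ otherwise; a variable $X_{\Omega}^{\mathrm{term}}$ (standing for $\Theta^{\Omega}(\boldsymbol{\psi})(n)$) for a proof link $\boldsymbol{\psi}(n)$; and $\Theta^{\Omega}(\boldsymbol{\psi})(a)$ for $\boldsymbol{\psi}(a)$, where the $\Theta^{\Omega_i}(\boldsymbol{\psi})$, $\Omega_i$ ranging over all configurations of the end-sequent of $\boldsymbol\psi$, are defined by mutual recursion $\Theta^{\Omega_i}(\boldsymbol{\psi})(0)\equiv\Theta^{\Omega_i}(\psi_{base})$, $\Theta^{\Omega_i}(\boldsymbol{\psi})(n+1)\equiv\Theta^{\Omega_i}(\psi_{rec})$. **Atom set schemata and top clause sets.** An atom set schema is a finite set $\mathcal{A}$ of pairs $\langle P,a\rangle$ with $P$ a propositional symbol and $a$ an arithmetic expression; $\mathcal{A}\downarrow N=\bigcup_{\langle P,a\rangle\in\mathcal{A}}\{P(0),P(1),\dots,P(a\downarrow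 N)\}$. It is an atom set schema for $T$ if for every $N$ all atoms occurring in clauses of $|T\downarrow N|$ lie in $\mathcal{A}\downarrow N$. The top clause set is $\mathrm{CL}^t(\{A_1,\dots,A_k\})=\{A_1\vdash;\ \vdash A_1\}\times\dots\times\{A_k\vdash;\ \vdash A_k\}$, and $\mathrm{CL}^t(\emptyset)=\{\vdash\}$. **Resolution.** For clauses $C=\Gamma\vdash\Delta$, $D=\Pi\vdash\Lambda$ and an atom $A$, $\mathrm{res}(C,D;A)=\Gamma,\Pi'\vdash\Delta',\Lambda$, where $\Pi',\Delta'$ are $\Pi,\Delta$ with all occurrences of $A$ removed. Resolution deductions from a clause set $\mathcal{C}$: each $C\in\mathcal{C}$, with end-clause $C$; and $\mathrm{r}(\gamma_1,\gamma_2;A)$, with end-clause the resolvent with respect to $A$ of the end-clauses of $\gamma_1,\gamma_2$. Resolution proof schemata: clause schemata are extended by clause variables $X_i^{\mathrm{clause}}$, composition $\circ$, and clause schemata defined by primitive recursion in $n$; resolution proof schemata are clause schemata, $\mathrm{r}(\rho_1,\rho_2;A)$ with $A$ an atom schema, and $\boldsymbol{\rho}(a;C_1,\dots,C_k)$ with $C_i$ clause schemata and $\boldsymbol{\rho}$ specified by $\boldsymbol{\rho}(0;\vec X^{\mathrm{clause}})\equiv\rho_{base}$, $\boldsymbol{\rho}(n+1;\vec X^{\mathrm{clause}})\equiv\rho_{rec}$, where $\rho_{rec}$ may contain recursive calls $\boldsymbol{\rho}(n;D_1,\dots,D_k)$ with clause schemata $D_i$, and both may contain the variables $\vec X^{\mathrm{clause}}$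 and previously defined symbols. For closed $\rho$, $\rho\downarrow N$ is obtained by setting $n=N$ and unfolding. -}

module Defs where

open import Data.Empty using (⊥; ⊥-elim)
open import Data.Fin.Base using (Fin; zero; suc)
open import Data.List.Base
  using (List; []; _∷_; [_]; _++_; _∷ʳ_; map; concatMap; upTo; filter; deduplicate; lookup; length;
         cartesianProduct; cartesianProductWith)
open import Data.List.Membership.Propositional using (_∈_)
open import Data.List.Membership.Propositional.Properties
  using (∈-map⁺; ∈-++⁺ˡ; ∈-++⁺ʳ; ∈-cartesianProduct⁺)
open import Data.List.Relation.Binary.Permutation.Propositional using (_↭_)
open import Data.List.Relation.Binary.Pointwise using (Pointwise; []; _∷_)
open import Data.List.Relation.Unary.All using (All; []; _∷_; universal)
open import Data.List.Relation.Unary.All.Properties using (map⁺; map⁻; ++⁺; ++⁻ˡ; ++⁻ʳ; ∷ʳ⁺; ∷ʳ⁻)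
open import Data.List.Relation.Unary.Any using (Any; here; there; index)
open import Data.Maybe.Base as Maybe using (Maybe; just; nothing; maybe′)
open import Data.Nat.Base using (ℕ; zero; suc; _+_; _*_)
import Data.Nat.Properties as ℕ
open import Data.Product.Base using (∃-syntax; _×_; _,_; proj₁; proj₂; map₁; map₂)
open import Data.Product.Properties using (≡-dec)
open import Data.Sum.Base using (_⊎_; inj₁; inj₂)
open import Data.Vec.Functional as Vector using (Vector)
open import Function.Base using (id; _∘_)
open import Relation.Binary.Construct.Closure.Reflexive using (ReflClosure)
open import Relation.Binary.Construct.Closure.Symmetric using (SymClosure)
open import Relation.Binary.Definitions using (DecidableEquality)
open import Relation.Binary.PropositionalEquality.Core using (_≡_; refl)
open import Relation.Nullary.Decidable using (¬?)

------------------------------------------------------------------------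
-- Arithmetic expressions

infix 9 _·n+_
infixl 8 _↓_ _[n↦_]

record Arith : Set where
  constructor _·n+_
  field
    coeff const : ℕ

_↓_ : Arith → ℕ → ℕ
(α ·n+ β) ↓ N = α * N + β

_[n↦_] : Arith → Arith → Arith
(α ·n+ β) [n↦ α′ ·n+ β′ ] = (α * α′) ·n+ (α * β′ + β)

const : ℕ → Arith
const c = 0 ·n+ c

n n+1 : Arith
n   = 1 ·n+ 0
n+1 = 1 ·n+ 1

------------------------------------------------------------------------
-- Atoms, sequents and clauses
--
-- Syntax is indexed by the type I of indices: I = ℕ gives objects without
-- the parameter n, I = Arith gives schemata.

PSym : Set
PSym = ℕ

AtomOver : Set → Set
AtomOver I = PSym × I

Atom AtomSchema : Set
Atom       = AtomOver ℕ
AtomSchema = AtomOver Arith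

_≟ᵃ_ : DecidableEquality Atom
_≟ᵃ_ = ≡-dec ℕ._≟_ ℕ._≟_

infix 3 _⊢_

record Sequent (X : Set) : Set where
  constructor _⊢_
  field
    antecedent succedent : List X

open Sequent public

mapSequent : ∀ {X Y} → (X → Y) → Sequent X → Sequent Y
mapSequent f (Γ ⊢ Δ) = map f Γ ⊢ map f Δ

infixr 6 _⊚_

_⊚_ : ∀ {X} → Sequent X → Sequent X → Sequent X
(Γ ⊢ Δ) ⊚ (Π ⊢ Λ) = Γ ++ Π ⊢ Δ ++ Λ

Clause ClauseSchema : Set
Clause       = Sequent Atom
ClauseSchema = Sequent AtomSchema

mapClause : ∀ {I J} → (I → J) → Sequent (AtomOver I) → Sequent (AtomOver J)
mapClause f = mapSequent (map₂ f)

infix 4 _≈_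

-- Clauses are identified up to the order of their atoms.
_≈_ : Clause → Clause → Set
(Γ ⊢ Δ) ≈ (Π ⊢ Λ) = (Γ ↭ Π) × (Δ ↭ Λ)

ClauseSet : Set
ClauseSet = List Clause

_×ᶜ_ : ClauseSet → ClauseSet → ClauseSet
_×ᶜ_ = cartesianProductWith _⊚_

------------------------------------------------------------------------
-- Formulas and propositional schemata

infix  8 ∼_
infixr 7 _∧_
infixr 6 _∨_
infixr 5 _⊃_

-- D is the type of further leaves: defined symbols applied to an index, and
-- X^prop.
data Formula (I D : Set) : Set where
  atom        : AtomOver I → Formula I D
  symb        : D → Formula I D
  ∼_          : Formula I D → Formula I D
  _∧_ _∨_ _⊃_ : Formula I D → Formula I D → Formula I D

bind : ∀ {I J D E} → (I → J) → (D → Formula J E) → Formula I D → Formula J E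
bind f g (atom (P , a)) = atom (P , f a)
bind f g (symb d)       = g d
bind f g (∼ F)          = ∼ bind f g F
bind f g (F ∧ G)        = bind f g F ∧ bind f g G
bind f g (F ∨ G)        = bind f g F ∨ bind f g G
bind f g (F ⊃ G)        = bind f g F ⊃ bind f g G

PropFormula : Set
PropFormula = Formula ℕ ⊥

-- Schemata over k defined symbols; (i , a) stands for 𝐏ᵢ(a).
Schema : ℕ → Set
Schema k = Formula Arith (Fin k × Arith)

-- Schemata which may in addition contain X^prop, written symb nothing.
XSchema : ℕ → Set
XSchema k = Formula Arith (Maybe (Fin k × Arith))

-- Specifications 𝐏(0) ≡ base, 𝐏(n+1) ≡ rec of k symbols, each of which may
-- use those introduced before it.  The most recent symbol has index zero.
data FormulaSig : ℕ → Set where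
  ∅       : FormulaSig 0
  _▸⟨_∣_⟩ : ∀ {k} → FormulaSig k → (base : PropFormula) (rec : XSchema k) → FormulaSig (suc k)

baseᶠ : ∀ {k} → FormulaSig k → Fin k → PropFormula
baseᶠ (Σ ▸⟨ b ∣ r ⟩) zero    = b
baseᶠ (Σ ▸⟨ b ∣ r ⟩) (suc i) = baseᶠ Σ i

weaken : ∀ {k} → XSchema k → XSchema (suc k)
weaken = bind id (symb ∘ Maybe.map (map₁ suc))

recᶠ : ∀ {k} → FormulaSig k → Fin k → XSchema k
recᶠ (Σ ▸⟨ b ∣ r ⟩) zero    = weaken r
recᶠ (Σ ▸⟨ b ∣ r ⟩) (suc i) = weaken (recᶠ Σ i)

-- 𝐏ᵢ(m) fully unfolded.
unfold : ∀ {k} → FormulaSig k → Fin k → ℕ → PropFormula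
unfold (Σ ▸⟨ b ∣ r ⟩)   (suc i) m       = unfold Σ i m
unfold (Σ ▸⟨ b ∣ r ⟩)   zero    zero    = b
unfold S@(Σ ▸⟨ b ∣ r ⟩) zero    (suc m) = bind (_↓ m)
  (maybe′ (λ (i , a) → unfold Σ i (a ↓ m)) (unfold S zero m)) r

evalFormula : ∀ {k} → FormulaSig k → ℕ → Schema k → PropFormula
evalFormula Σ N = bind (_↓ N) λ (i , a) → unfold Σ i (a ↓ N)

substFormula : ∀ {k} → Arith → Schema k → Schema k
substFormula a = bind (_[n↦ a ]) λ (i , b) → symb (i , b [n↦ a ])

-- F [n ↦ a] [X^prop ↦ G]
substXFormula : ∀ {k} → Arith → Schema k → XSchema k → Schema k
substXFormula a G = bind (_[n↦ a ]) (maybe′ (λ (i , b) → symb (i , b [n↦ a ])) G)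

embed : ∀ {k} → PropFormula → Schema k
embed = bind const ⊥-elim

data Unfolds {k} (Σ : FormulaSig k) : Schema k → Schema k → Set where
  base : ∀ i → Unfolds Σ (symb (i , const 0)) (embed (baseᶠ Σ i))
  step : ∀ i α β → Unfolds Σ (symb (i , α ·n+ (β + 1)))
                             (substXFormula (α ·n+ β) (symb (i , α ·n+ β)) (recᶠ Σ i))

SequentSchema : ℕ → Set
SequentSchema k = Sequent (Schema k)

-- The relation ↔_def on formulas.
Def : ∀ {k} → FormulaSig k → Schema k → Schema k → Set
Def Σ = ReflClosure (SymClosure (Unfolds Σ))

------------------------------------------------------------------------
-- Proofs

private variable
  I D        : Set
  F G        : Formula I D
  Γ Δ Π Λ    : List (Formula I D)

-- _↔_ is the relation on formulas applied by the def rule; Leaf describes the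
-- sequents that may be used as leaves in addition to the initial sequents.
data LK {I D : Set} (_↔_ : Formula I D → Formula I D → Set)
        (Leaf : Sequent (Formula I D) → Set) : Sequent (Formula I D) → Set where
  init : ∀ A → LK _↔_ Leaf ([ atom A ] ⊢ [ atom A ])
  leaf : ∀ {S} → Leaf S → LK _↔_ Leaf S
  def  : Pointwise _↔_ Γ Π → Pointwise _↔_ Δ Λ →
         LK _↔_ Leaf (Γ ⊢ Δ) → LK _↔_ Leaf (Π ⊢ Λ)

  w:l : LK _↔_ Leaf (Γ ⊢ Δ) → LK _↔_ Leaf (F ∷ Γ ⊢ Δ)
  w:r : LK _↔_ Leaf (Γ ⊢ Δ) → LK _↔_ Leaf (Γ ⊢ Δ ∷ʳ F)
  c:l : LK _↔_ Leaf (F ∷ F ∷ Γ ⊢ Δ) → LK _↔_ Leaf (F ∷ Γ ⊢ Δ)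
  c:r : LK _↔_ Leaf (Γ ⊢ Δ ∷ʳ F ∷ʳ F) → LK _↔_ Leaf (Γ ⊢ Δ ∷ʳ F)
  e:l : ∀ Γ → LK _↔_ Leaf (Γ ++ F ∷ G ∷ Π ⊢ Δ) → LK _↔_ Leaf (Γ ++ G ∷ F ∷ Π ⊢ Δ)
  e:r : ∀ Δ → LK _↔_ Leaf (Γ ⊢ Δ ++ F ∷ G ∷ Λ) → LK _↔_ Leaf (Γ ⊢ Δ ++ G ∷ F ∷ Λ)

  cut : LK _↔_ Leaf (Γ ⊢ Δ ∷ʳ F) → LK _↔_ Leaf (F ∷ Π ⊢ Λ) → LK _↔_ Leaf (Γ ++ Π ⊢ Δ ++ Λ)

  ∼:l : LK _↔_ Leaf (Γ ⊢ Δ ∷ʳ F) → LK _↔_ Leaf (∼ F ∷ Γ ⊢ Δ)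
  ∼:r : LK _↔_ Leaf (F ∷ Γ ⊢ Δ) → LK _↔_ Leaf (Γ ⊢ Δ ∷ʳ ∼ F)

  ∧:l₁ : LK _↔_ Leaf (F ∷ Γ ⊢ Δ) → LK _↔_ Leaf (F ∧ G ∷ Γ ⊢ Δ)
  ∧:l₂ : LK _↔_ Leaf (G ∷ Γ ⊢ Δ) → LK _↔_ Leaf (F ∧ G ∷ Γ ⊢ Δ)
  ∧:r  : LK _↔_ Leaf (Γ ⊢ Δ ∷ʳ F) → LK _↔_ Leaf (Γ ⊢ Δ ∷ʳ G) → LK _↔_ Leaf (Γ ⊢ Δ ∷ʳ (F ∧ G))

  ∨:l  : LK _↔_ Leaf (F ∷ Γ ⊢ Δ) → LK _↔_ Leaf (G ∷ Γ ⊢ Δ) → LK _↔_ Leaf (F ∨ G ∷ Γ ⊢ Δ)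
  ∨:r₁ : LK _↔_ Leaf (Γ ⊢ Δ ∷ʳ F) → LK _↔_ Leaf (Γ ⊢ Δ ∷ʳ (F ∨ G))
  ∨:r₂ : LK _↔_ Leaf (Γ ⊢ Δ ∷ʳ G) → LK _↔_ Leaf (Γ ⊢ Δ ∷ʳ (F ∨ G))

  ⊃:l  : LK _↔_ Leaf (Γ ⊢ Δ ∷ʳ F) → LK _↔_ Leaf (G ∷ Π ⊢ Λ) →
         LK _↔_ Leaf ((F ⊃ G) ∷ Γ ++ Π ⊢ Δ ++ Λ)
  ⊃:r  : LK _↔_ Leaf (F ∷ Γ ⊢ Δ ∷ʳ G) → LK _↔_ Leaf (Γ ⊢ Δ ∷ʳ (F ⊃ G))

PropProof : Sequent PropFormula → Set
PropProof = LK (λ _ _ → ⊥) (λ _ → ⊥)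

-- Leaves of a proof schema, where Ss lists the end-sequents of the available
-- defined proof symbols and link is the sequent of the admissible proof link.
data ProofLeaf {k} (Ss : List (SequentSchema k)) (link : Maybe (SequentSchema k)) :
               SequentSchema k → Set where
  call      : ∀ {S} → S ∈ Ss → (a : Arith) → ProofLeaf Ss link (mapSequent (substFormula a) S)
  proofLink : ∀ {S} → link ≡ just S → ProofLeaf Ss link S

Proof : ∀ {k} → FormulaSig k → List (SequentSchema k) → Maybe (SequentSchema k) →
        SequentSchema k → Set
Proof Σ Ss link = LK (Def Σ) (ProofLeaf Ss link)

-- Specifications 𝛗(0) ≡ base, 𝛗(n+1) ≡ rec of defined proof symbols, indexed by
-- their end-sequents, most recent first.
data ProofSig {k} (Σ : FormulaSig k) : List (SequentSchema k) → Set where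
  ∅         : ProofSig Σ []
  _▸_⟨_∣_⟩ : ∀ {Ss} → ProofSig Σ Ss → (S : SequentSchema k) →
              (base : PropProof (mapSequent (evalFormula Σ 0) S))
              (rec  : Proof Σ Ss (just S) (mapSequent (substFormula n+1) S)) →
              ProofSig Σ (S ∷ Ss)

record ProofSchema : Set where
  field
    {symbols}      : ℕ
    formulaSig     : FormulaSig symbols
    {endSequents}  : List (SequentSchema symbols)
    proofSig       : ProofSig formulaSig endSequents
    {endSequent}   : SequentSchema symbols
    proof          : Proof formulaSig endSequents nothing endSequent

------------------------------------------------------------------------
-- Clause set term schemata

infixr 6 _⊕_
infixr 7 _⊗_

data Term (I D : Set) : Set where
  ⌈_⌉     : Sequent (AtomOver I) → Term I D
  symb    : D → Term I D
  _⊕_ _⊗_ : Term I D → Term I D → Term I D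

bindᵗ : ∀ {I J D E} → (I → J) → (D → Term J E) → Term I D → Term J E
bindᵗ f g ⌈ C ⌉    = ⌈ mapClause f C ⌉
bindᵗ f g (symb d) = g d
bindᵗ f g (T ⊕ U)  = bindᵗ f g T ⊕ bindᵗ f g U
bindᵗ f g (T ⊗ U)  = bindᵗ f g T ⊗ bindᵗ f g U

GroundTerm : Set
GroundTerm = Term ℕ ⊥

∣_∣ : GroundTerm → ClauseSet
∣ ⌈ C ⌉ ∣ = [ C ]
∣ T ⊕ U ∣ = ∣ T ∣ ++ ∣ U ∣
∣ T ⊗ U ∣ = ∣ T ∣ ×ᶜ ∣ U ∣

-- Ms lists the sizes of the blocks of mutually defined symbols; v is the
-- number of variables.  call b i a stands for the i-th symbol of block b
-- applied to a.
data TermSym (Ms : List ℕ) (v : ℕ) : Set where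
  var  : Fin v → TermSym Ms v
  call : ∀ {M} → M ∈ Ms → Fin M → Arith → TermSym Ms v

TermOver : List ℕ → ℕ → Set
TermOver Ms v = Term Arith (TermSym Ms v)

-- Each block specifies 𝐓ⁱ(0) ≡ base i and 𝐓ⁱ(n+1) ≡ rec i for i < M.  In rec,
-- var j stands for 𝐓ʲ(n).
data TermSig : List ℕ → Set where
  ∅       : TermSig []
  _▸⟨_∣_⟩ : ∀ {M Ms} → TermSig Ms →
            (base : Fin M → GroundTerm) (rec : Fin M → TermOver Ms M) → TermSig (M ∷ Ms)

symCase : ∀ {Ms v} {A : Set} → (Fin v → A) → (∀ {M} → M ∈ Ms → Fin M → Arith → A) →
          TermSym Ms v → A
symCase f g (var i)      = f i
symCase f g (call p i a) = g p i a

unfoldᵗ : ∀ {M Ms} → TermSig Ms → M ∈ Ms → Fin M → ℕ → GroundTerm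
unfoldᵗ (Σ ▸⟨ b ∣ r ⟩)   (there p)   i m       = unfoldᵗ Σ p i m
unfoldᵗ (Σ ▸⟨ b ∣ r ⟩)   (here refl) i zero    = b i
unfoldᵗ S@(Σ ▸⟨ b ∣ r ⟩) (here refl) i (suc m) = bindᵗ (_↓ m)
  (symCase (λ j → unfoldᵗ S (here refl) j m) (λ p j a → unfoldᵗ Σ p j (a ↓ m))) (r i)

record TermSchema : Set where
  constructor termSchema
  field
    {blocks} : List ℕ
    termSig  : TermSig blocks
    term     : TermOver blocks 0

evalTerm : TermSchema → ℕ → GroundTerm
evalTerm (termSchema Σ T) N = bindᵗ (_↓ N) (symCase (λ ()) (λ p i a → unfoldᵗ Σ p i (a ↓ N))) T

------------------------------------------------------------------------
-- Configurations

data Mark : Set where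
  ■ □ : Mark

Marks : ∀ {X : Set} → List X → Set
Marks = All (λ _ → Mark)

Config : ∀ {X : Set} → Sequent X → Set
Config (Γ ⊢ Δ) = Marks Γ × Marks Δ

tracked : ∀ {X : Set} (xs : List X) → Marks xs → List X
tracked []       []       = []
tracked (x ∷ xs) (■ ∷ ms) = x ∷ tracked xs ms
tracked (x ∷ xs) (□ ∷ ms) = tracked xs ms

_∙_ : ∀ {X : Set} (S : Sequent X) → Config S → Sequent X
(Γ ⊢ Δ) ∙ (γ , δ) = tracked Γ γ ⊢ tracked Δ δ

∅ᶜ : ∀ {X : Set} {S : Sequent X} → Config S
∅ᶜ {S = Γ ⊢ Δ} = universal (λ _ → □) Γ , universal (λ _ → □) Δ

-- S, S[n ↦ a] and S↓N have the same formula occurrences, hence the same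
-- configurations.
mapConfig⁺ : ∀ {X Y : Set} {f : X → Y} {S : Sequent X} → Config S → Config (mapSequent f S)
mapConfig⁺ (γ , δ) = map⁺ γ , map⁺ δ

mapConfig⁻ : ∀ {X Y : Set} {f : X → Y} {S : Sequent X} → Config (mapSequent f S) → Config S
mapConfig⁻ (γ , δ) = map⁻ γ , map⁻ δ

pointwise⁻ : ∀ {X : Set} {R : X → X → Set} {xs ys : List X} → Pointwise R xs ys → Marks ys → Marks xs
pointwise⁻ []       []       = []
pointwise⁻ (_ ∷ rs) (m ∷ ms) = m ∷ pointwise⁻ rs ms

swap : ∀ {X : Set} (xs : List X) {x y : X} {zs : List X} →
       Marks (xs ++ y ∷ x ∷ zs) → Marks (xs ++ x ∷ y ∷ zs)
swap []       (m ∷ m′ ∷ ms) = m′ ∷ m ∷ ms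
swap (_ ∷ xs) (m ∷ ms)      = m ∷ swap xs ms

-- The enumeration of all configurations turns the block of symbols Θ^Ω, Ω
-- ranging over the configurations of a sequent, into one indexed by Fin M.
allMarks : ∀ {X : Set} (xs : List X) → List (Marks xs)
allMarks []       = [ [] ]
allMarks (x ∷ xs) = map (■ ∷_) (allMarks xs) ++ map (□ ∷_) (allMarks xs)

∈-allMarks : ∀ {X : Set} {xs : List X} (ms : Marks xs) → ms ∈ allMarks xs
∈-allMarks []       = here refl
∈-allMarks (■ ∷ ms) = ∈-++⁺ˡ (∈-map⁺ (■ ∷_) (∈-allMarks ms))
∈-allMarks {xs = x ∷ xs} (□ ∷ ms) = ∈-++⁺ʳ (map (■ ∷_) (allMarks xs)) (∈-map⁺ (□ ∷_) (∈-allMarks ms))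

allConfigs : ∀ {X : Set} (S : Sequent X) → List (Config S)
allConfigs (Γ ⊢ Δ) = cartesianProduct (allMarks Γ) (allMarks Δ)

∈-allConfigs : ∀ {X : Set} {S : Sequent X} (Ω : Config S) → Ω ∈ allConfigs S
∈-allConfigs (γ , δ) = ∈-cartesianProduct⁺ (∈-allMarks γ) (∈-allMarks δ)

#configs : ∀ {X : Set} → Sequent X → ℕ
#configs S = length (allConfigs S)

configIndex : ∀ {X : Set} {S : Sequent X} → Config S → Fin (#configs S)
configIndex Ω = index (∈-allConfigs Ω)

configAt : ∀ {X : Set} {S : Sequent X} → Fin (#configs S) → Config S
configAt {S = S} = lookup (allConfigs S)

------------------------------------------------------------------------
-- The characteristic term

-- ⊕ if the principal formula is tracked, ⊗ otherwise.
combine : ∀ {I D} → Mark → Term I D → Term I D → Term I D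
combine ■ = _⊕_
combine □ = _⊗_

module _ {I D E : Set} {_↔_ : Formula I D → Formula I D → Set}
         {Leaf : Sequent (Formula I D) → Set}
         (θ : ∀ {S} → Leaf S → Config S → Term I E) where

  Θ : ∀ {S} → LK _↔_ Leaf S → Config S → Term I E
  Θ (init A) (m ∷ [] , m′ ∷ []) = ⌈ ([ A ] ⊢ [ A ]) ∙ (m ∷ [] , m′ ∷ []) ⌉
  Θ (leaf l) Ω                  = θ l Ω
  Θ (def ps qs φ) (γ , δ)       = Θ φ (pointwise⁻ ps γ , pointwise⁻ qs δ)
  Θ (w:l φ)   (_ ∷ γ , δ)       = Θ φ (γ , δ)
  Θ (w:r φ)   (γ , δ)           = Θ φ (γ , proj₁ (∷ʳ⁻ δ))
  Θ (c:l φ)   (m ∷ γ , δ)       = Θ φ (m ∷ m ∷ γ , δ)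
  Θ (c:r φ)   (γ , δ)           = Θ φ (γ , ∷ʳ⁺ δ (proj₂ (∷ʳ⁻ δ)))
  Θ (e:l Γ φ) (γ , δ)           = Θ φ (swap Γ γ , δ)
  Θ (e:r Δ φ) (γ , δ)           = Θ φ (γ , swap Δ δ)
  Θ (cut {Γ = Γ} {Δ = Δ} φ ψ) (γ , δ) =
    Θ φ (++⁻ˡ Γ γ , ∷ʳ⁺ (++⁻ˡ Δ δ) ■) ⊕ Θ ψ (■ ∷ ++⁻ʳ Γ γ , ++⁻ʳ Δ δ)
  Θ (∼:l φ)   (m ∷ γ , δ)       = Θ φ (γ , ∷ʳ⁺ δ m)
  Θ (∼:r φ)   (γ , δ) with ∷ʳ⁻ δ
  ... | δ′ , m                  = Θ φ (m ∷ γ , δ′)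
  Θ (∧:l₁ φ)  (m ∷ γ , δ)       = Θ φ (m ∷ γ , δ)
  Θ (∧:l₂ φ)  (m ∷ γ , δ)       = Θ φ (m ∷ γ , δ)
  Θ (∧:r φ ψ) (γ , δ) with ∷ʳ⁻ δ
  ... | δ′ , m                  = combine m (Θ φ (γ , ∷ʳ⁺ δ′ m)) (Θ ψ (γ , ∷ʳ⁺ δ′ m))
  Θ (∨:l φ ψ) (m ∷ γ , δ)       = combine m (Θ φ (m ∷ γ , δ)) (Θ ψ (m ∷ γ , δ))
  Θ (∨:r₁ φ)  (γ , δ) with ∷ʳ⁻ δ
  ... | δ′ , m                  = Θ φ (γ , ∷ʳ⁺ δ′ m)
  Θ (∨:r₂ φ)  (γ , δ) with ∷ʳ⁻ δ
  ... | δ′ , m                  = Θ φ (γ , ∷ʳ⁺ δ′ m)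
  Θ (⊃:l {Γ = Γ} {Δ = Δ} φ ψ) (m ∷ γ , δ) =
    combine m (Θ φ (++⁻ˡ Γ γ , ∷ʳ⁺ (++⁻ˡ Δ δ) m)) (Θ ψ (m ∷ ++⁻ʳ Γ γ , ++⁻ʳ Δ δ))
  Θ (⊃:r φ)   (γ , δ) with ∷ʳ⁻ δ
  ... | δ′ , m                  = Θ φ (m ∷ γ , ∷ʳ⁺ δ′ m)

-- Every defined proof symbol yields one block, with a symbol for each
-- configuration of its end-sequent.
charBlocks : ∀ {k} → List (SequentSchema k) → List ℕ
charBlocks = map #configs

#vars : ∀ {k} → Maybe (SequentSchema k) → ℕ
#vars nothing  = 0
#vars (just S) = #configs S

charLeaf : ∀ {k} {Ss : List (SequentSchema k)} {link S} →
           ProofLeaf Ss link S → Config S → TermOver (charBlocks Ss) (#vars link)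
charLeaf (call {S} p a)   Ω = symb (call (∈-map⁺ #configs p) (configIndex (mapConfig⁻ {S = S} Ω)) a)
charLeaf (proofLink refl) Ω = symb (var (configIndex Ω))

charSig : ∀ {k} {Σ : FormulaSig k} {Ss} → ProofSig Σ Ss → TermSig (charBlocks Ss)
charSig ∅                 = ∅
charSig (Ψ ▸ S ⟨ φ ∣ ψ ⟩) = charSig Ψ
  ▸⟨ (λ i → Θ (λ ()) φ (mapConfig⁺ {S = S} (configAt i)))
   ∣ (λ i → Θ charLeaf ψ (mapConfig⁺ {S = S} (configAt i))) ⟩

charTerm : (φ : ProofSchema) → Config (ProofSchema.endSequent φ) → TermSchema
charTerm φ Ω = termSchema (charSig proofSig) (Θ charLeaf proof Ω)
  where open ProofSchema φ

IsCharacteristic : TermSchema → Set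
IsCharacteristic T = ∃[ φ ] T ≡ charTerm φ ∅ᶜ

------------------------------------------------------------------------
-- Atom set schemata and top clause sets

AtomSetSchema : Set
AtomSetSchema = List (PSym × Arith)

-- The finite set 𝒜↓N, as a list without repetitions.
evalAtomSet : AtomSetSchema → ℕ → List Atom
evalAtomSet 𝒜 N = deduplicate _≟ᵃ_ (concatMap (λ (P , a) → map (P ,_) (upTo (suc (a ↓ N)))) 𝒜)

IsAtomSetSchemaFor : AtomSetSchema → TermSchema → Set
IsAtomSetSchemaFor 𝒜 T = ∀ N C → C ∈ ∣ evalTerm T N ∣ →
  ∀ A → A ∈ antecedent C ⊎ A ∈ succedent C → A ∈ evalAtomSet 𝒜 N

CLᵗ : List Atom → ClauseSet
CLᵗ []       = [ [] ⊢ [] ]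
CLᵗ (A ∷ As) = (([ A ] ⊢ []) ∷ ([] ⊢ [ A ]) ∷ []) ×ᶜ CLᵗ As

------------------------------------------------------------------------
-- Resolution deductions

data Deduction : Set where
  clause : Clause → Deduction
  r      : Deduction → Deduction → Atom → Deduction

_∖_ : List Atom → Atom → List Atom
Γ ∖ A = filter (λ B → ¬? (A ≟ᵃ B)) Γ

res : Clause → Clause → Atom → Clause
res (Γ ⊢ Δ) (Π ⊢ Λ) A = Γ ++ (Π ∖ A) ⊢ (Δ ∖ A) ++ Λ

endClause : Deduction → Clause
endClause (clause C)   = C
endClause (r γ₁ γ₂ A) = res (endClause γ₁) (endClause γ₂) A

_IsFrom_ : Deduction → ClauseSet → Set
clause C   IsFrom 𝒞 = Any (C ≈_) 𝒞
r γ₁ γ₂ A IsFrom 𝒞 = γ₁ IsFrom 𝒞 × γ₂ IsFrom 𝒞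

------------------------------------------------------------------------
-- Resolution proof schemata

-- Clause schemata extended by v clause variables, composition and defined
-- clause symbols, whose numbers of clause arguments are listed in cs.
data ClauseExp (I : Set) (cs : List ℕ) (v : ℕ) : Set where
  ⌈_⌉  : Sequent (AtomOver I) → ClauseExp I cs v
  var  : Fin v → ClauseExp I cs v
  _⊚ᵉ_ : ClauseExp I cs v → ClauseExp I cs v → ClauseExp I cs v
  call : ∀ {l} → l ∈ cs → I → Vector (ClauseExp I cs v) l → ClauseExp I cs v

-- Specifications 𝐜(0; X⃗) ≡ base, 𝐜(n+1; X⃗) ≡ rec.  In rec, var zero stands
-- for 𝐜(n; X⃗) and var (suc i) for Xᵢ.
data ClauseSig : List ℕ → Set where
  ∅       : ClauseSig []
  _▸⟨_∣_⟩ : ∀ {l cs} → ClauseSig cs →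
            (base : ClauseExp ℕ cs l) (rec : ClauseExp Arith cs (suc l)) → ClauseSig (l ∷ cs)

evalClauseExp : ∀ {I cs v} → (∀ {l} → l ∈ cs → ℕ → Vector Clause l → Clause) →
                (I → ℕ) → Vector Clause v → ClauseExp I cs v → Clause
evalClauseExp c f X ⌈ C ⌉         = mapClause f C
evalClauseExp c f X (var i)       = X i
evalClauseExp c f X (C ⊚ᵉ D)      = evalClauseExp c f X C ⊚ evalClauseExp c f X D
evalClauseExp c f X (call p a Cs) = c p (f a) (λ i → evalClauseExp c f X (Cs i))

unfoldᶜ : ∀ {cs l} → ClauseSig cs → l ∈ cs → ℕ → Vector Clause l → Clause
unfoldᶜ (Σ ▸⟨ b ∣ s ⟩)   (there p)   m       X = unfoldᶜ Σ p m X
unfoldᶜ (Σ ▸⟨ b ∣ s ⟩)   (here refl) zero    X = evalClauseExp (unfoldᶜ Σ) id X b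
unfoldᶜ S@(Σ ▸⟨ b ∣ s ⟩) (here refl) (suc m) X =
  evalClauseExp (unfoldᶜ Σ) (_↓ m) (unfoldᶜ S (here refl) m X Vector.∷ X) s

-- rs lists the numbers of clause arguments of the available defined resolution
-- symbols; self is that of the symbol being specified, if recursive calls
-- 𝛒(n; D⃗) are admitted.
data ResExp (I : Set) (cs rs : List ℕ) (self : Maybe ℕ) (v : ℕ) : Set where
  clause : ClauseExp I cs v → ResExp I cs rs self v
  r      : ResExp I cs rs self v → ResExp I cs rs self v → AtomOver I → ResExp I cs rs self v
  call   : ∀ {k} → k ∈ rs → I → Vector (ClauseExp I cs v) k → ResExp I cs rs self v
  rec    : ∀ {k} → self ≡ just k → Vector (ClauseExp I cs v) k → ResExp I cs rs self v

data ResSig (cs : List ℕ) : List ℕ → Set where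
  ∅       : ResSig cs []
  _▸⟨_∣_⟩ : ∀ {k rs} → ResSig cs rs →
            (base : ResExp ℕ cs rs nothing k) (rec : ResExp Arith cs rs (just k) k) →
            ResSig cs (k ∷ rs)

evalResExp : ∀ {I cs rs self v} → ClauseSig cs →
             (∀ {k} → k ∈ rs → ℕ → Vector Clause k → Deduction) →
             (∀ {k} → self ≡ just k → Vector Clause k → Deduction) →
             (I → ℕ) → Vector Clause v → ResExp I cs rs self v → Deduction
evalResExp Σ d s f X (clause C)         = clause (evalClauseExp (unfoldᶜ Σ) f X C)
evalResExp Σ d s f X (r ρ₁ ρ₂ (P , a)) = r (evalResExp Σ d s f X ρ₁) (evalResExp Σ d s f X ρ₂) (P , f a)
evalResExp Σ d s f X (call p a Cs)      = d p (f a) (λ i → evalClauseExp (unfoldᶜ Σ) f X (Cs i))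
evalResExp Σ d s f X (rec p Cs)         = s p (λ i → evalClauseExp (unfoldᶜ Σ) f X (Cs i))

onSelf : ∀ {k} {A : Set} → (Vector Clause k → A) → ∀ {l} → just k ≡ just l → Vector Clause l → A
onSelf f refl = f

unfoldʳ : ∀ {cs rs k} → ClauseSig cs → ResSig cs rs → k ∈ rs → ℕ → Vector Clause k → Deduction
unfoldʳ Σ (R ▸⟨ b ∣ s ⟩)    (there p)   m       X = unfoldʳ Σ R p m X
unfoldʳ Σ (R ▸⟨ b ∣ s ⟩)    (here refl) zero    X = evalResExp Σ (unfoldʳ Σ R) (λ ()) id X b
unfoldʳ Σ R′@(R ▸⟨ b ∣ s ⟩) (here refl) (suc m) X =
  evalResExp Σ (unfoldʳ Σ R) (onSelf (unfoldʳ Σ R′ (here refl) m)) (_↓ m) X s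

record ResolutionSchema : Set where
  field
    {clauseArities} : List ℕ
    clauseSig       : ClauseSig clauseArities
    {resArities}    : List ℕ
    resSig          : ResSig clauseArities resArities
    resolution      : ResExp Arith clauseArities resArities nothing 0

evalResolution : ResolutionSchema → ℕ → Deduction
evalResolution ρ N = evalResExp clauseSig (unfoldʳ clauseSig resSig) (λ ()) (_↓ N) Vector.[] resolution
  where open ResolutionSchema ρ

------------------------------------------------------------------------
-- Refutation schemata

IsRefutationSchema : TermSchema → AtomSetSchema → ResolutionSchema → Set
IsRefutationSchema T 𝒜 ρ =
  IsAtomSetSchemaFor 𝒜 T ×
  (∀ N → evalResolution ρ N IsFrom CLᵗ (evalAtomSet 𝒜 N) ×
         endClause (evalResolution ρ N) ≈ ([] ⊢ []))

{-# OPTIONS --safe #-}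

-- The index of every symbol occurring in a clause set term schema is an
-- arithmetic expression, and these are closed under composition and dominated
-- by their sums; so all atoms of |T↓N| are among the P(i) with P < K and
-- i ≤ a↓N, for some K and a that do not depend on N.  Taking one expression a
-- for all propositional symbols lets a single recursion refute the top clause
-- set: 𝛒(m; X) resolves on P(m) for every P < K and calls 𝛒(m - 1; X ∘ L),
-- where L records the chosen literals.  A separate recursion for each P would
-- fail, as it forgets a↓N before the next P is reached.
module Submission where

open import Defs
open import Data.Fin.Base using (Fin; zero; suc)
open import Data.List.Base
  using (List; []; _∷_; [_]; _++_; map; upTo; downFrom; cartesianProductWith)
open import Data.List.Membership.Propositional using (_∈_; find)
open import Data.List.Membership.Propositional.Properties
  using (∈-++⁻; ∈-map⁺; ∈-map⁻; ∈-concatMap⁺; ∈-concatMap⁻; ∈-deduplicate⁺; ∈-deduplicate⁻;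
         ∈-upTo⁺; ∈-upTo⁻; ∈-downFrom⁺; ∈-downFrom⁻; ∈-filter⁻; ∈-∃++;
         ∈-cartesianProductWith⁺; ∈-cartesianProductWith⁻)
open import Data.List.Membership.Propositional.Properties.WithK using (unique∧set⇒bag)
open import Data.List.Properties using (++-identityʳ)
open import Data.List.Relation.Binary.BagAndSetEquality using (∼bag⇒↭)
open import Data.List.Relation.Binary.Permutation.Propositional
  using (_↭_; ↭-refl; ↭-sym; ↭-trans; ↭-prep; ↭-reflexive)
open import Data.List.Relation.Binary.Permutation.Propositional.Properties
  using (shift; drop-∷; ∈-resp-↭; ↭-empty-inv)
  renaming (++⁺ˡ to ↭-++⁺ˡ; ++⁺ʳ to ↭-++⁺ʳ)
open import Data.List.Relation.Binary.Subset.Propositional using (_⊆_)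
open import Data.List.Relation.Binary.Subset.Propositional.Properties using (⊆[]⇒≡[])
open import Data.List.Relation.Unary.All as All using (All; []; _∷_)
open import Data.List.Relation.Unary.All.Properties using (map⁺; ++⁺)
open import Data.List.Relation.Unary.Any as Any using (Any; here; there)
import Data.List.Relation.Unary.Any.Properties as Any
open import Data.List.Relation.Unary.Unique.Propositional.Properties
  using (upTo⁺; downFrom⁺; cartesianProductWith⁺)
open import Data.List.Relation.Unary.Unique.DecPropositional.Properties _≟ᵃ_ using (deduplicate-!)
open import Data.Maybe.Base using (Maybe; just)
open import Data.Nat.Base using (ℕ; zero; suc; _+_; _*_; _≤_; _<_; s≤s; s≤s⁻¹)
open import Data.Nat.Properties
  using (≤-refl; ≤-reflexive; ≤-trans; m≤m+n; m≤n+m; n≤1+n; +-mono-≤; +-monoˡ-≤; *-monoˡ-≤; *-monoʳ-≤)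
open import Data.Nat.Tactic.RingSolver using (solve-∀)
open import Data.Product.Base using (∃-syntax; _×_; _,_; proj₁; proj₂; map₂)
open import Data.Sum.Base using (inj₁; inj₂)
open import Data.Vec.Functional using (Vector)
open import Function.Base using (id; _∘_)
open import Function.Bundles using (mk⇔)
open import Relation.Binary.PropositionalEquality using (_≡_; refl; sym; subst)
open import Relation.Nullary.Negation using (contradiction)

-- Linear bounds on the atoms of a term schema

Bound : Set
Bound = ℕ × Arith

Region : Bound → ℕ → Atom → Set
Region (K , a) N (P , i) = P < K × i ≤ a ↓ N

infixl 6 _⊔_

-- A sum rather than a maximum: the pointwise maximum of two arithmetic expressions need not be one.
_⊔_ : Bound → Bound → Bound
(K , α ·n+ β) ⊔ (K′ , α′ ·n+ β′) = K + K′ , (α + α′) ·n+ (β + β′)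

↓-monoʳ : ∀ a {M N} → M ≤ N → a ↓ M ≤ a ↓ N
↓-monoʳ (α ·n+ β) M≤N = +-monoˡ-≤ β (*-monoʳ-≤ α M≤N)

↓-[n↦] : ∀ a b N → a [n↦ b ] ↓ N ≡ a ↓ (b ↓ N)
↓-[n↦] (α ·n+ β) (α′ ·n+ β′) N = lemma α β α′ β′ N
  where
  lemma : ∀ α β α′ β′ N → α * α′ * N + (α * β′ + β) ≡ α * (α′ * N + β′) + β
  lemma = solve-∀

Region-mono : ∀ B {M N} → M ≤ N → ∀ {A} → Region B M A → Region B N A
Region-mono (K , a) M≤N (P<K , i≤) = P<K , ≤-trans i≤ (↓-monoʳ a M≤N)

Region-⊔ˡ : ∀ B C N {A} → Region B N A → Region (B ⊔ C) N A
Region-⊔ˡ (K , α ·n+ β) (K′ , α′ ·n+ β′) N (P<K , i≤) =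
  ≤-trans P<K (m≤m+n K K′) ,
  ≤-trans i≤ (+-mono-≤ (*-monoˡ-≤ N (m≤m+n α α′)) (m≤m+n β β′))

Region-⊔ʳ : ∀ B C N {A} → Region C N A → Region (B ⊔ C) N A
Region-⊔ʳ (K , α ·n+ β) (K′ , α′ ·n+ β′) N (P<K , i≤) =
  ≤-trans P<K (m≤n+m K′ K) ,
  ≤-trans i≤ (+-mono-≤ (*-monoˡ-≤ N (m≤n+m α′ α)) (m≤n+m β′ β))

-- Quantifying over all P that contain the region makes boundedness closed
-- under enlarging the bound, without asking Q to be monotone.
Bounded : (ℕ → (Atom → Set) → Set) → Set₁
Bounded Q = ∃[ B ] (∀ N P → (∀ {A} → Region B N A → P A) → Q N P)

bounded-× : ∀ {Q R} → Bounded Q → Bounded R → Bounded (λ N P → Q N P × R N P)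
bounded-× (B , q) (C , s) = B ⊔ C , λ N P ⊆P →
  q N P (λ {A} → ⊆P ∘ Region-⊔ˡ B C N) , s N P (λ {A} → ⊆P ∘ Region-⊔ʳ B C N)

bounded-All : ∀ {X : Set} {Q : X → ℕ → (Atom → Set) → Set} →
              (∀ x → Bounded (Q x)) → ∀ xs → Bounded (λ N P → All (λ x → Q x N P) xs)
bounded-All q []       = (0 , const 0) , λ _ _ _ → []
bounded-All q (x ∷ xs) =
  let B , q′ = bounded-× (q x) (bounded-All q xs)
  in B , λ N P ⊆P → let p , ps = q′ N P ⊆P in p ∷ ps

bounded-Fin : ∀ {M} {Q : Fin M → ℕ → (Atom → Set) → Set} →
              (∀ i → Bounded (Q i)) → Bounded (λ N P → ∀ i → Q i N P)
bounded-Fin {zero}  q = (0 , const 0) , λ _ _ _ ()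
bounded-Fin {suc M} q =
  let B , q′ = bounded-× (q zero) (bounded-Fin (q ∘ suc))
  in B , λ { N P ⊆P zero → proj₁ (q′ N P ⊆P) ; N P ⊆P (suc i) → proj₂ (q′ N P ⊆P) i }

bounded-atom : ∀ A → Bounded (λ N P → P (map₂ (_↓ N) A))
bounded-atom (P , a) = (suc P , a) , λ _ _ ⊆P → ⊆P (≤-refl , ≤-refl)

bounded-ground-atom : ∀ A → Bounded (λ _ P → P A)
bounded-ground-atom (P , i) = bounded-atom (P , const i)

-- Atoms and symbols get separate predicates, so that one traversal serves ground terms as well as
-- schemata whose symbols are still to be unfolded.
Covered : ∀ {I D} → (AtomOver I → Set) → (D → Set) → Term I D → Set
Covered P Q ⌈ Γ ⊢ Δ ⌉ = All P Γ × All P Δ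
Covered P Q (symb d)  = Q d
Covered P Q (T ⊕ U)   = Covered P Q T × Covered P Q U
Covered P Q (T ⊗ U)   = Covered P Q T × Covered P Q U

Atoms⊆ : (Atom → Set) → GroundTerm → Set
Atoms⊆ P = Covered P (λ ())

covered-bind : ∀ {I J D E} {f : I → J} {g : D → Term J E} {P Q} {Q′ : D → Set} →
               (∀ d → Q′ d → Covered P Q (g d)) →
               ∀ T → Covered (P ∘ map₂ f) Q′ T → Covered P Q (bindᵗ f g T)
covered-bind s ⌈ Γ ⊢ Δ ⌉ (p , q) = map⁺ p , map⁺ q
covered-bind s (symb d)  p       = s d p
covered-bind s (T ⊕ U)   (p , q) = covered-bind s T p , covered-bind s U q
covered-bind s (T ⊗ U)   (p , q) = covered-bind s T p , covered-bind s U q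

atoms⊆-mono : ∀ {P Q : Atom → Set} → (∀ {A} → P A → Q A) → ∀ T → Atoms⊆ P T → Atoms⊆ Q T
atoms⊆-mono P⊆Q ⌈ Γ ⊢ Δ ⌉ (p , q) = All.map P⊆Q p , All.map P⊆Q q
atoms⊆-mono P⊆Q (T ⊕ U)   (p , q) = atoms⊆-mono P⊆Q T p , atoms⊆-mono P⊆Q U q
atoms⊆-mono P⊆Q (T ⊗ U)   (p , q) = atoms⊆-mono P⊆Q T p , atoms⊆-mono P⊆Q U q

atoms⊆-∣∣ : ∀ {P} T → Atoms⊆ P T → ∀ {C} → C ∈ ∣ T ∣ → All P (antecedent C) × All P (succedent C)
atoms⊆-∣∣ ⌈ C ⌉   p       (here refl) = p
atoms⊆-∣∣ (T ⊕ U) (p , q) C∈ with ∈-++⁻ ∣ T ∣ C∈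
... | inj₁ C∈T = atoms⊆-∣∣ T p C∈T
... | inj₂ C∈U = atoms⊆-∣∣ U q C∈U
atoms⊆-∣∣ (T ⊗ U) (p , q) C∈ with ∈-cartesianProductWith⁻ _⊚_ ∣ T ∣ ∣ U ∣ C∈
... | _ , _ , D∈T , E∈U , refl =
  let p₁ , p₂ = atoms⊆-∣∣ T p D∈T
      q₁ , q₂ = atoms⊆-∣∣ U q E∈U
  in ++⁺ p₁ q₁ , ++⁺ p₂ q₂

-- A term has finitely many leaves, so the sum of their bounds serves them all, uniformly in `N`.
bounded-term : ∀ {I D} {R : AtomOver I → ℕ → (Atom → Set) → Set} {Q : D → ℕ → (Atom → Set) → Set} →
               (∀ A → Bounded (R A)) → (∀ d → Bounded (Q d)) →
               ∀ T → Bounded (λ N P → Covered (λ A → R A N P) (λ d → Q d N P) T)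
bounded-term a s ⌈ Γ ⊢ Δ ⌉ = bounded-× (bounded-All a Γ) (bounded-All a Δ)
bounded-term a s (symb d)  = s d
bounded-term a s (T ⊕ U)   = bounded-× (bounded-term a s T) (bounded-term a s U)
bounded-term a s (T ⊗ U)   = bounded-× (bounded-term a s T) (bounded-term a s U)

bounded-ground : ∀ T → Bounded (λ _ P → Atoms⊆ P T)
bounded-ground = bounded-term bounded-ground-atom (λ ())

UnfoldBound : ∀ {Ms} → TermSig Ms → Bound → Set
UnfoldBound {Ms} Σ B = ∀ {M} (p : M ∈ Ms) i N → Atoms⊆ (Region B N) (unfoldᵗ Σ p i N)

module _ {Ms} (Σ : TermSig Ms) B (uΣ : UnfoldBound Σ B) where

  interpret : ∀ {v} → (ℕ → Fin v → GroundTerm) → ℕ → TermSym Ms v → GroundTerm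
  interpret g N = symCase (g N) (λ p i a → unfoldᵗ Σ p i (a ↓ N))

  -- A variable adds nothing to the bound, as the hypothesis covers it; a call is bounded at
  -- `a ↓ N`, which composition with `a` expresses in terms of `N`.
  bounded-interpret : ∀ {v} (g : ℕ → Fin v → GroundTerm) s →
    Bounded (λ N P → (∀ j → Atoms⊆ P (g N j)) → Atoms⊆ P (interpret g N s))
  bounded-interpret g (var j)      = (0 , const 0) , λ _ _ _ hyp → hyp j
  bounded-interpret g (call p i a) = (proj₁ B , proj₂ B [n↦ a ]) , λ N P ⊆P _ →
    atoms⊆-mono (λ {A} (P<K , i≤) → ⊆P (P<K , ≤-trans i≤ (≤-reflexive (sym (↓-[n↦] (proj₂ B) a N)))))
      (unfoldᵗ Σ p i (a ↓ N)) (uΣ p i (a ↓ N))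

  bounded-bind : ∀ {v} (g : ℕ → Fin v → GroundTerm) T →
    Bounded (λ N P → (∀ j → Atoms⊆ P (g N j)) → Atoms⊆ P (bindᵗ (_↓ N) (interpret g N) T))
  bounded-bind g T =
    let C , t = bounded-term bounded-atom (bounded-interpret g) T
    in C , λ N P ⊆P hyp → covered-bind (λ _ s → s hyp) T (t N P ⊆P)

-- `B` serves the earlier blocks, `C` the base and recursive terms of the newest one. The same bound
-- survives every recursion step, so nothing accumulates.
bounded-unfold : ∀ {Ms} (Σ : TermSig Ms) → ∃[ B ] UnfoldBound Σ B
bounded-unfold ∅ = (0 , const 0) , λ ()
bounded-unfold S@(_▸⟨_∣_⟩ {M} Σ b s) = B ⊔ C , bound
  where
  B  = proj₁ (bounded-unfold Σ)
  uΣ = proj₂ (bounded-unfold Σ)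

  block : ℕ → Fin M → GroundTerm
  block N j = unfoldᵗ S (here refl) j N

  bounded-block : Bounded _
  bounded-block = bounded-× (bounded-Fin (λ i → bounded-ground (b i)))
                            (bounded-Fin (λ i → bounded-bind Σ B uΣ block (s i)))
  C = proj₁ bounded-block

  bound : UnfoldBound S (B ⊔ C)
  bound (there p)   i N       = atoms⊆-mono (Region-⊔ˡ B C N) (unfoldᵗ Σ p i N) (uΣ p i N)
  bound (here refl) i zero    = proj₁ (proj₂ bounded-block 0 _ (Region-⊔ʳ B C 0)) i
  -- Both `s i` and its variables are evaluated at `m`, so all atoms lie in the region at `m`, hence
  -- in that at `suc m`.
  bound (here refl) i (suc m) = atoms⊆-mono (Region-mono (B ⊔ C) (n≤1+n m)) (block (suc m) i)
    (proj₂ (proj₂ bounded-block m _ (Region-⊔ʳ B C m)) i (λ j → bound (here refl) j m))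

bounded-evalTerm : ∀ T → Bounded (λ N P → Atoms⊆ P (evalTerm T N))
bounded-evalTerm (termSchema Σ T) =
  let B , uΣ = bounded-unfold Σ
      C , t  = bounded-bind Σ B uΣ (λ _ ()) T
  in C , λ N P ⊆P → t N P ⊆P (λ ())

-- The atom set

atomSet : Bound → AtomSetSchema
atomSet (K , a) = map (_, a) (upTo K)

∈-atomSet⁺ : ∀ B N {A} → Region B N A → A ∈ evalAtomSet (atomSet B) N
∈-atomSet⁺ (K , a) N {P , i} (P<K , i≤) = ∈-deduplicate⁺ _≟ᵃ_ (∈-concatMap⁺ _
  (Any.map⁺ (Any.map (λ { refl → ∈-map⁺ (P ,_) (∈-upTo⁺ (s≤s i≤)) }) (∈-upTo⁺ P<K))))

∈-atomSet⁻ : ∀ B N {A} → A ∈ evalAtomSet (atomSet B) N → Region B N A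
∈-atomSet⁻ (K , a) N A∈
  with P , P∈ , A∈′ ← find (Any.map⁻ (∈-concatMap⁻ _ (∈-deduplicate⁻ _≟ᵃ_ _ A∈)))
  with _ , i∈ , refl ← ∈-map⁻ (P ,_) A∈′ = ∈-upTo⁻ P∈ , s≤s⁻¹ (∈-upTo⁻ i∈)

-- Follows the order of resolution: highest index first, so that each unfolding step prepends one
-- row.
grid : ℕ → ℕ → List Atom
grid K b = cartesianProductWith (λ i P → P , i) (downFrom b) (upTo K)

-- One list is sorted by index, the other by symbol; both are free of repetitions, so having the
-- same members makes them permutations of each other.
grid↭atomSet : ∀ K a N → grid K (suc (a ↓ N)) ↭ evalAtomSet (atomSet (K , a)) N
grid↭atomSet K a N = ∼bag⇒↭ (unique∧set⇒bag
  (cartesianProductWith⁺ (λ i P → P , i) (λ { refl → refl , refl }) (downFrom⁺ (suc (a ↓ N))) (upTo⁺ K))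
  (deduplicate-! _)
  (mk⇔ to from))
  where
  to : ∀ {A} → A ∈ grid K (suc (a ↓ N)) → A ∈ evalAtomSet (atomSet (K , a)) N
  to A∈ with _ , _ , i∈ , P∈ , refl ← ∈-cartesianProductWith⁻ _ (downFrom (suc (a ↓ N))) (upTo K) A∈ =
    ∈-atomSet⁺ (K , a) N (∈-upTo⁻ P∈ , s≤s⁻¹ (∈-downFrom⁻ i∈))

  from : ∀ {A} → A ∈ evalAtomSet (atomSet (K , a)) N → A ∈ grid K (suc (a ↓ N))
  from A∈ = let P<K , i≤ = ∈-atomSet⁻ (K , a) N A∈
            in ∈-cartesianProductWith⁺ _ (∈-downFrom⁺ (s≤s i≤)) (∈-upTo⁺ P<K)

-- Refuting the top clause set

∈⇒↭∷ : ∀ {A : Atom} {xs} → A ∈ xs → ∃[ ys ] xs ↭ A ∷ ys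
∈⇒↭∷ A∈ with ys , zs , refl ← ∈-∃++ A∈ = ys ++ zs , shift _ ys zs

-- The side on which the head atom occurs selects its unit clause; removing that occurrence leaves a
-- clause for the remaining atoms.
∈-CLᵗ : ∀ As {Γ Δ} → Γ ++ Δ ↭ As → Any ((Γ ⊢ Δ) ≈_) (CLᵗ As)
∈-CLᵗ [] {[]} {[]}      _ = here (↭-refl , ↭-refl)
∈-CLᵗ [] {[]} {_ ∷ _}   p = contradiction (↭-empty-inv p) λ ()
∈-CLᵗ [] {_ ∷ _}        p = contradiction (↭-empty-inv p) λ ()
∈-CLᵗ (A ∷ As) {Γ} {Δ} p with ∈-++⁻ Γ (∈-resp-↭ (↭-sym p) (here refl))
... | inj₁ A∈Γ with Γ′ , q ← ∈⇒↭∷ A∈Γ =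
  Any.++⁺ˡ (Any.map⁺ (Any.map (λ (s , t) → ↭-trans q (↭-prep A s) , t)
    (∈-CLᵗ As (drop-∷ (↭-trans (↭-sym (↭-++⁺ʳ Δ q)) p)))))
... | inj₂ A∈Δ with Δ′ , q ← ∈⇒↭∷ A∈Δ =
  Any.++⁺ʳ (map _ (CLᵗ As)) (Any.++⁺ˡ (Any.map⁺ (Any.map (λ (s , t) → s , ↭-trans q (↭-prep A t))
    (∈-CLᵗ As (drop-∷ (↭-trans (↭-sym (↭-trans (↭-++⁺ˡ Γ q) (shift A Γ Δ′))) p))))))

∖-⊆ : ∀ {A xs ys} → xs ⊆ A ∷ ys → xs ∖ A ⊆ ys
∖-⊆ xs⊆ B∈ with B∈xs , A≢B ← ∈-filter⁻ _ B∈ with xs⊆ B∈xs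
... | here refl  = contradiction refl A≢B
... | there B∈ys = B∈ys

++-⊆ : ∀ {xs ys zs : List Atom} → xs ⊆ zs → ys ⊆ zs → xs ++ ys ⊆ zs
++-⊆ {xs} xs⊆ ys⊆ x∈ with ∈-++⁻ xs x∈
... | inj₁ x∈xs = xs⊆ x∈xs
... | inj₂ x∈ys = ys⊆ x∈ys

-- X holds the literals chosen so far and Rs the atoms still to be resolved on.
-- Resolving keeps both copies of X, so the end-clause agrees with X only up to
-- repetitions.
record Derives (Rs : List Atom) (X : Clause) (d : Deduction) : Set where
  field
    from : ∀ {As} → Rs ++ antecedent X ++ succedent X ↭ As → d IsFrom CLᵗ As
    ant⊆ : antecedent (endClause d) ⊆ antecedent X
    suc⊆ : succedent (endClause d) ⊆ succedent X

open Derives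

derives-clause : ∀ X → Derives [] X (clause X)
derives-clause X .from p = ∈-CLᵗ _ p
derives-clause X .ant⊆   = id
derives-clause X .suc⊆   = id

-- The premises put `A` on opposite sides, just where `res` deletes it. Either way the pending and
-- chosen atoms together are only permuted.
derives-r : ∀ {Rs X d₁ d₂ A} → Derives Rs (([] ⊢ [ A ]) ⊚ X) d₁ → Derives Rs (([ A ] ⊢ []) ⊚ X) d₂ →
            Derives (A ∷ Rs) X (r d₁ d₂ A)
derives-r {Rs} {Γ ⊢ Δ} {A = A} δ₁ δ₂ .from p =
  δ₁ .from (↭-trans (↭-++⁺ˡ Rs (shift A Γ Δ)) (↭-trans (shift A Rs _) p)) ,
  δ₂ .from (↭-trans (shift A Rs _) p)
derives-r δ₁ δ₂ .ant⊆ = ++-⊆ (δ₁ .ant⊆) (∖-⊆ (δ₂ .ant⊆))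
derives-r δ₁ δ₂ .suc⊆ = ++-⊆ (∖-⊆ (δ₁ .suc⊆)) (δ₂ .suc⊆)

-- The recursive resolution schema

module _ {I : Set} {cs rs : List ℕ} {self : Maybe ℕ} {v : ℕ} where

  -- The number of symbols does not depend on the parameter, so the case split at one index is
  -- written out as a finite tree. Its leaves `ℓ` are clauses at index 0 and recursive calls above.
  splitLevel : (ClauseExp I cs v → ResExp I cs rs self v) → I → List PSym →
               ClauseExp I cs v → ResExp I cs rs self v
  splitLevel ℓ i []       C = ℓ C
  splitLevel ℓ i (P ∷ Ps) C = r (splitLevel ℓ i Ps (⌈ [] ⊢ [ P , i ] ⌉ ⊚ᵉ C))
                                (splitLevel ℓ i Ps (⌈ [ P , i ] ⊢ [] ⌉ ⊚ᵉ C)) (P , i)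

  derives-splitLevel : ∀ (Σ : ClauseSig cs) (c : ∀ {k} → k ∈ rs → ℕ → Vector Clause k → Deduction)
    (s : ∀ {k} → self ≡ just k → Vector Clause k → Deduction) (f : I → ℕ) X {ℓ Rs} →
    (∀ C → Derives Rs (evalClauseExp (unfoldᶜ Σ) f X C) (evalResExp Σ c s f X (ℓ C))) →
    ∀ i Ps C → Derives (map (_, f i) Ps ++ Rs) (evalClauseExp (unfoldᶜ Σ) f X C)
                       (evalResExp Σ c s f X (splitLevel ℓ i Ps C))
  derives-splitLevel Σ c s f X δ i []       C = δ C
  derives-splitLevel Σ c s f X δ i (P ∷ Ps) C =
    derives-r (derives-splitLevel Σ c s f X δ i Ps _) (derives-splitLevel Σ c s f X δ i Ps _)

gridSig : ℕ → ResSig [] (1 ∷ [])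
gridSig K = ∅ ▸⟨ splitLevel clause 0 (upTo K) (var zero)
               ∣ splitLevel (λ C → rec refl (λ _ → C)) n+1 (upTo K) (var zero) ⟩

-- Argument `m` treats the indices 0 to `m`, hence `suc m` rows. `X` is arbitrary because recursive
-- calls receive enlarged clauses.
derives-grid : ∀ K m X → Derives (grid K (suc m)) (X zero) (unfoldʳ ∅ (gridSig K) (here refl) m X)
derives-grid K zero    X = derives-splitLevel ∅ _ (λ ()) id X (λ _ → derives-clause _) 0 (upTo K) (var zero)
derives-grid K (suc m) X =
  -- The index `n+1` evaluates to `1 * m + 1`, which is `suc m` only propositionally.
  subst (λ i → Derives (map (_, i) (upTo K) ++ grid K (suc m)) (X zero)
                       (unfoldʳ ∅ (gridSig K) (here refl) (suc m) X))
    (n+1-↓ m)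
    (derives-splitLevel ∅ (unfoldʳ ∅ ∅) (onSelf (unfoldʳ ∅ (gridSig K) (here refl) m)) (_↓ m) X
      (λ C → derives-grid K m (λ _ → evalClauseExp (unfoldᶜ ∅) (_↓ m) X C)) n+1 (upTo K) (var zero))
  where
  n+1-↓ : ∀ m → 1 * m + 1 ≡ suc m
  n+1-↓ = solve-∀

refutation : Bound → ResolutionSchema
refutation (K , a) = record
  { clauseSig  = ∅
  ; resSig     = gridSig K
  ; resolution = call (here refl) a (λ _ → ⌈ [] ⊢ [] ⌉)
  }

refutation-correct : ∀ B N → evalResolution (refutation B) N IsFrom CLᵗ (evalAtomSet (atomSet B) N) ×
                             endClause (evalResolution (refutation B) N) ≈ ([] ⊢ [])
refutation-correct (K , a) N =
  δ .from (↭-trans (↭-reflexive (++-identityʳ _)) (grid↭atomSet K a N)) ,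
  -- Inclusion in the empty clause leaves no room for repetitions.
  ↭-reflexive (⊆[]⇒≡[] (δ .ant⊆)) , ↭-reflexive (⊆[]⇒≡[] (δ .suc⊆))
  where
  δ : Derives (grid K (suc (a ↓ N))) ([] ⊢ []) (evalResolution (refutation (K , a)) N)
  δ = derives-grid K (a ↓ N) _

theorem8 : (Θ₀ : TermSchema) → IsCharacteristic Θ₀ → ∃[ 𝒜 ] ∃[ ρ ] IsRefutationSchema Θ₀ 𝒜 ρ
theorem8 Θ₀ _ = atomSet B , refutation B , covers , refutation-correct B
  where
  B = proj₁ (bounded-evalTerm Θ₀)

  covers : IsAtomSetSchemaFor (atomSet B) Θ₀
  covers N C C∈ A A∈
    -- The bound is applied to its own region, the smallest predicate it admits.
    with p , q ← atoms⊆-∣∣ (evalTerm Θ₀ N) (proj₂ (bounded-evalTerm Θ₀) N (Region B N) id) C∈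
    with A∈
  ... | inj₁ A∈ant = ∈-atomSet⁺ B N (All.lookup p A∈ant)
  ... | inj₂ A∈suc = ∈-atomSet⁺ B N (All.lookup q A∈suc)
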